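{- Let $\lambda$ be a nonzero real (or complex) number and let $k\in\mathbb{Z}$. For every integer $n\ge 1$, $$\beta_{n,\lambda}^{(k)}(1)-\beta_{n,\lambda}^{(k)}=(-1)^{n}\sum_{m=1}^{n}\frac{(1)_{m,1/\lambda}}{m^{k-1}}\lambda^{m-1}S_{2,\lambda}(n,m).$$
   Context: All generating functions are formal power series. For nonzero $\lambda$ and any $x$, the degenerate exponential is $e_\lambda^x(t)=(1+\lambda t)^{x/\lambda}=\sum_{n\ge0}\binom{x/\lambda}{n}\lambda^n t^n$ and $e_\lambda(t)=e_\lambda^1(t)$. For nonzero $\mu$, put $(1)_{0,\mu}=1$ and $(1)_{n,\mu}=(1-\mu)(1-2\mu)\cdots(1-(n-1)\mu)$ for $n\ge1$ (so $(1)_{1,\mu}=1$). The degenerate Stirling numbers of the second kind $S_{2,\lambda}(n,m)$ are defined, for each $m\ge0$, by $\frac{1}{m!}(e_{\lambda}(t)-1)^{m}=\sum_{n=m}^{\infty}S_{2,\lambda}(n,m)\frac{t^{n}}{n!}$. For $k\in\mathbb{Z}$ the degenerate polylogarithm function is $l_{k,\lambda}(x)=\sum_{n=1}^{\infty}\frac{(-\lambda)^{n-1}(1)_{n,1/\lambda}}{(n-1)!\,n^{k}}x^{n}$. The degenerate poly-Bernoulli polynomials $\beta_{n,\lambda}^{(k)}(x)$ are defined by $$\frac{l_{k,\lambda}(1-e_{\lambda}(-t))}{1-e_{\lambda}(-t)}\,e_\lambda^x(-t)=\sum_{n=0}^{\infty}\beta_{n,\lambda}^{(k)}(x)\frac{t^{n}}{n!},$$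 where the first factor is obtained by substituting $y=1-e_\lambda(-t)$ (which has zero constant term) into the power series $l_{k,\lambda}(y)/y$. The degenerate poly-Bernoulli numbers are $\beta_{n,\lambda}^{(k)}=\beta_{n,\lambda}^{(k)}(0)$. -}

module Defs where

open import Algebra.Apartness.Bundles using (HeytingField; HeytingCommutativeRing)
open import Algebra.Bundles using (CommutativeRing)
import Algebra.Apartness.Properties.HeytingCommutativeRing as HCRProperties
import Algebra.Properties.CommutativeMonoid.Sum as SumProperties
import Algebra.Properties.Semiring.Exp as ExpProperties
import Algebra.Properties.Semiring.Mult as MultProperties
open import Data.Fin.Base using (toℕ)
open import Data.Integer.Base using (ℤ; +_; -[1+_])
open import Data.Nat.Base using (ℕ; zero; suc; _∸_; NonZero; _!)
open import Data.Nat.Properties using (_!≢0)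
open import Data.Product.Base using (_,_; proj₁; proj₂)
open import Function.Base using (_∘_)
open import Level using (Level; _⊔_)

private
  variable
    c ℓ₁ ℓ₂ : Level

-- ℝ and ℂ enter as Heyting fields of characteristic zero, with x # 0#
-- (invertibility of x) in the role of x ≠ 0; classically # is ≠.
module _ (K : HeytingField c ℓ₁ ℓ₂) where
  open HeytingField K
  open HeytingCommutativeRing heytingCommutativeRing using (commutativeRing)
  open MultProperties (CommutativeRing.semiring commutativeRing) using (_×_)

  CharacteristicZero : Set ℓ₂
  CharacteristicZero = ∀ n → .{{NonZero n}} → (n × 1#) # 0#

module DegeneratePolyBernoulli
  (K : HeytingField c ℓ₁ ℓ₂) (char0 : CharacteristicZero K) where

  open HeytingField K
  open HeytingCommutativeRing heytingCommutativeRing using (commutativeRing)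
  open HCRProperties heytingCommutativeRing using (1#0; x-0≈x; x#0y#0→xy#0; invertibleˡ⇒#)
  open MultProperties (CommutativeRing.semiring commutativeRing) public using (_×_)
  open ExpProperties (CommutativeRing.semiring commutativeRing) public using (_^_)
  open SumProperties (CommutativeRing.+-commutativeMonoid commutativeRing) public
    using (sum; sum-syntax)

  infixl 7 _/_
  infixl 7 _*ⁿ_
  infixr 8 _^ⁿ_ _^ᶻ_
  infix  9 _⁻¹

  record Nonzero : Set (c ⊔ ℓ₂) where
    constructor mkNonzero
    field
      value   : Carrier
      value#0 : value # 0#

  open Nonzero public

  1ⁿ : Nonzero
  1ⁿ = mkNonzero 1# 1#0

  _*ⁿ_ : Nonzero → Nonzero → Nonzero
  mkNonzero x x#0 *ⁿ mkNonzero y y#0 = mkNonzero (x * y) (x#0y#0→xy#0 x#0 y#0)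

  -- #⇒invertible provides an inverse of x - 0#, which is one of x.
  _⁻¹ : Nonzero → Nonzero
  mkNonzero x x#0 ⁻¹ = mkNonzero (proj₁ inv) (invertibleˡ⇒# (x , x*[y-0]≈1))
    where
    inv = #⇒invertible x#0
    x*[y-0]≈1 : x * (proj₁ inv - 0#) ≈ 1#
    x*[y-0]≈1 = trans (*-cong (sym (x-0≈x x)) (x-0≈x (proj₁ inv))) (proj₂ (proj₂ inv))

  _^ⁿ_ : Nonzero → ℕ → Nonzero
  x ^ⁿ zero  = 1ⁿ
  x ^ⁿ suc n = x *ⁿ x ^ⁿ n

  _^ᶻ_ : Nonzero → ℤ → Nonzero
  x ^ᶻ (+ n)    = x ^ⁿ n
  x ^ᶻ -[1+ n ] = (x ^ⁿ suc n) ⁻¹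

  _/_ : Carrier → Nonzero → Carrier
  x / y = x * value (y ⁻¹)

  ι : ℕ → Carrier
  ι n = n × 1#

  ι⁺ : (n : ℕ) .{{_ : NonZero n}} → Nonzero
  ι⁺ n = mkNonzero (ι n) (char0 n)

  ι! : ℕ → Nonzero
  ι! n = ι⁺ (n !) {{n !≢0}}

  -- x (x - μ) (x - 2μ) ⋯ (x - (n - 1)μ), usually written (x)_{n,μ}
  falling : Carrier → ℕ → Carrier → Carrier
  falling x zero    μ = 1#
  falling x (suc n) μ = falling x n μ * (x - n × μ)

  binomial : Carrier → ℕ → Carrier
  binomial a n = falling a n 1# / ι! n

  -- A formal power series is its sequence of coefficients.
  Series : Set c
  Series = ℕ → Carrier

  infixl 7 _*ₛ_ _·ₛ_
  infixl 6 _-ₛ_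
  infixr 8 _^ₛ_

  1ₛ : Series
  1ₛ zero    = 1#
  1ₛ (suc _) = 0#

  _-ₛ_ : Series → Series → Series
  (f -ₛ g) n = f n - g n

  _·ₛ_ : Carrier → Series → Series
  (a ·ₛ f) n = a * f n

  _*ₛ_ : Series → Series → Series
  (f *ₛ g) n = ∑[ i < suc n ] (f (toℕ i) * g (n ∸ toℕ i))

  _^ₛ_ : Series → ℕ → Series
  f ^ₛ zero  = 1ₛ
  f ^ₛ suc m = f *ₛ f ^ₛ m

  -- f(-t)
  reflect : Series → Series
  reflect f n = (- 1#) ^ n * f n

  -- f(g(t)). As g has zero constant term, g^m contributes to the coefficient
  -- of t^n only for m ≤ n.
  substitute : Series → (g : Series) → g 0 ≈ 0# → Series
  substitute f g _ n = ∑[ m < suc n ] (f (toℕ m) * (g ^ₛ toℕ m) n)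

  -- f(t) / t, for f with zero constant term
  divideByVariable : Series → Series
  divideByVariable f = f ∘ suc

  -- a_n, where f(t) = ∑ a_n t^n / n!
  egfCoefficient : Series → ℕ → Carrier
  egfCoefficient f n = value (ι! n) * f n

  module _ (lam : Nonzero) where

    private
      l = value lam

    degExp : Carrier → Series
    degExp x n = binomial (x / lam) n * l ^ n

    S₂ : ℕ → ℕ → Carrier
    S₂ n m = egfCoefficient ((1# / ι! m) ·ₛ (degExp 1# -ₛ 1ₛ) ^ₛ m) n

    polylog : ℤ → Series
    polylog k zero        = 0#
    polylog k n@(suc n-1) =
      ((- l) ^ n-1 * falling 1# n (1# / lam)) / (ι! n-1 *ⁿ ι⁺ n ^ᶻ k)

    -- 1 - e_λ(-t)
    1-e[-t] : Series
    1-e[-t] = 1ₛ -ₛ reflect (degExp 1#)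

    1-e[-t]-constant : 1-e[-t] 0 ≈ 0#
    1-e[-t]-constant = trans (+-congˡ (-‿cong e≈1)) (-‿inverseʳ 1#)
      where
      1/1≈1 : 1# / ι! 0 ≈ 1#
      1/1≈1 = trans
        (*-congʳ (trans (sym (+-identityʳ 1#)) (sym (x-0≈x (1# + 0#)))))
        (proj₂ (proj₂ (#⇒invertible (value#0 (ι! 0)))))

      e≈1 : reflect (degExp 1#) 0 ≈ 1#
      e≈1 = trans (*-identityˡ _) (trans (*-identityʳ _) 1/1≈1)

    β : ℤ → ℕ → Carrier → Carrier
    β k n x = egfCoefficient
      (substitute (divideByVariable (polylog k)) 1-e[-t] 1-e[-t]-constant
        *ₛ reflect (degExp x))
      n

{-# OPTIONS --safe #-}
-- Put y = 1 - e_λ(-t). As e_λ⁰ = 1, the difference of the generating functions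
-- at 1 and 0 is (l(y)/y) (e_λ(-t) - 1) = -l(y). Since y = -(e_λ - 1)(-t), the
-- powers of y expand in the degenerate Stirling numbers, and the coefficients of
-- l(y) match those of the right-hand side by m! = m (m - 1)! and
-- m^k = m m^(k-1).
module Submission where

open import Defs
open import Algebra.Apartness.Bundles using (HeytingField; HeytingCommutativeRing)
open import Algebra.Bundles using (CommutativeRing)
import Algebra.Apartness.Properties.HeytingCommutativeRing as HCRProperties
import Algebra.Properties.CommutativeMonoid.Sum as SumProperties
import Algebra.Properties.CommutativeSemiring.Exp as ExpProperties
import Algebra.Properties.Ring as RingProperties
import Algebra.Properties.Semiring.Mult as MultProperties
import Algebra.Properties.Semiring.Sum as SemiringSumProperties
import Algebra.Solver.CommutativeMonoid as CommutativeMonoidSolver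
open import Data.Fin.Base using (Fin; toℕ; opposite)
open import Data.Fin.Permutation using (reverse)
open import Data.Fin.Properties using (opposite-prop; toℕ≤pred[n])
open import Data.Integer.Base using (ℤ; +_; -[1+_]; 1ℤ) renaming (_-_ to _-ᶻ_)
open import Data.Nat.Base using (ℕ; zero; suc; _∸_; _≤_; z≤n; s≤s; _!) renaming (_<_ to _<ⁿ_)
open import Data.Nat.Properties using (m+[n∸m]≡n; m∸[m∸n]≡n; m∸n≤m; n≤1+n; ≤-trans)
  renaming (+-identityʳ to +ⁿ-identityʳ)
open import Data.Product.Base using (proj₂)
open import Relation.Binary.PropositionalEquality.Core using (cong)
import Relation.Binary.Reasoning.Setoid as SetoidReasoning

module _ {c ℓ₁ ℓ₂} (K : HeytingField c ℓ₁ ℓ₂) (char0 : CharacteristicZero K) where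
  open HeytingField K
  open DegeneratePolyBernoulli K char0
  open HeytingCommutativeRing heytingCommutativeRing using (commutativeRing)
  open CommutativeRing commutativeRing
    using (ring; semiring; commutativeSemiring; +-commutativeMonoid; *-commutativeMonoid)
  open HCRProperties heytingCommutativeRing using (x-0≈x)
  open RingProperties ring using (-1*x≈-x; x[y-z]≈xy-xz; -‿involutive; ⁻¹-anti-homo‿-)
  open SumProperties +-commutativeMonoid
    using (sum-cong-≋; sum-replicate-zero; ∑-comm; ∑-permute; ∑-distrib-+)
  open SemiringSumProperties semiring using (*-distribˡ-sum; *-distribʳ-sum)
  open ExpProperties commutativeSemiring using (^-homo-*; ^-distrib-*; ^-congˡ)
  open MultProperties semiring using (×1-homo-*)
  open CommutativeMonoidSolver *-commutativeMonoid using (solve; _⊕_; _⊜_; id)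
  open SetoidReasoning setoid

  -- Finite sums and formal power series.

  sum-extend : ∀ {a b} → a ≤ b → (f : ℕ → Carrier) → (∀ m → a ≤ m → f m ≈ 0#) →
    ∑[ i < a ] f (toℕ i) ≈ ∑[ i < b ] f (toℕ i)
  sum-extend {zero} {b} _ f f≈0 =
    sym (trans (sum-cong-≋ {b} (λ i → f≈0 (toℕ i) z≤n)) (sum-replicate-zero b))
  sum-extend (s≤s a≤b) f f≈0 =
    +-congˡ (sum-extend a≤b (λ m → f (suc m)) (λ m a≤m → f≈0 (suc m) (s≤s a≤m)))

  -- Reversing the summation index exchanges `toℕ i` and `n ∸ toℕ i`. This is needed because `_^ₛ_`
  -- adds factors on the left, while `substitute-*ₛ` multiplies on the right.
  *ₛ-comm : ∀ f g n → (f *ₛ g) n ≈ (g *ₛ f) n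
  *ₛ-comm f g n = trans
    (∑-permute {suc n} (λ i → f (toℕ i) * g (n ∸ toℕ i)) reverse)
    (sum-cong-≋ {suc n} flip-term)
    where
    flip-term : (i : Fin (suc n)) →
      f (toℕ (opposite i)) * g (n ∸ toℕ (opposite i)) ≈ g (toℕ i) * f (n ∸ toℕ i)
    flip-term i rewrite opposite-prop i | m∸[m∸n]≡n (toℕ≤pred[n] i) = *-comm _ _

  -- Bilinearity of the Cauchy product, with difference and scalar in one statement so that it
  -- applies directly to e_λ(-t) - 1 = -y.
  *ₛ-distribˡ-difference : ∀ f g h r b → (∀ n → g n - h n ≈ b * r n) →
    ∀ n → (f *ₛ g) n - (f *ₛ h) n ≈ b * (f *ₛ r) n
  *ₛ-distribˡ-difference f g h r b g-h≈br n = begin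
    (f *ₛ g) n - (f *ₛ h) n
      -- Negation becomes multiplication by `- 1#`, which distributes over the sum and lets the two
      -- sums merge termwise.
      ≈⟨ +-congˡ (trans (sym (-1*x≈-x _)) (*-distribˡ-sum (- 1#) (terms h))) ⟩
    (f *ₛ g) n + ∑[ i < suc n ] (- 1# * terms h i)
      ≈⟨ ∑-distrib-+ (terms g) (λ i → - 1# * terms h i) ⟨
    ∑[ i < suc n ] (terms g i + - 1# * terms h i)
      ≈⟨ sum-cong-≋ {suc n} (λ i → term (f (toℕ i)) (n ∸ toℕ i)) ⟩
    ∑[ i < suc n ] (b * terms r i)
      ≈⟨ *-distribˡ-sum b (terms r) ⟨
    b * (f *ₛ r) n ∎
    where
    terms : Series → Fin (suc n) → Carrier
    terms x i = f (toℕ i) * x (n ∸ toℕ i)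

    term : ∀ x j → x * g j + - 1# * (x * h j) ≈ b * (x * r j)
    term x j = begin
      x * g j + - 1# * (x * h j) ≈⟨ +-congˡ (-1*x≈-x _) ⟩
      x * g j - x * h j          ≈⟨ x[y-z]≈xy-xz x (g j) (h j) ⟨
      x * (g j - h j)            ≈⟨ *-congˡ (g-h≈br j) ⟩
      x * (b * r j)              ≈⟨ solve 3 (λ x b y → x ⊕ (b ⊕ y) ⊜ b ⊕ (x ⊕ y)) refl x b (r j) ⟩
      b * (x * r j)              ∎

  -- Induction on the exponent: in `g *ₛ g ^ₛ m` the leading term contains `g 0`, and every other
  -- term contains a coefficient of `g ^ₛ m` at an index below `n ≤ m`.
  ^ₛ-vanishes : ∀ {g} → g 0 ≈ 0# → ∀ {n m} → n <ⁿ m → (g ^ₛ m) n ≈ 0#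
  ^ₛ-vanishes {g} g0 {n} {suc m} (s≤s n≤m) = begin
    g 0 * (g ^ₛ m) n + ∑[ i < n ] (g (suc (toℕ i)) * (g ^ₛ m) (n ∸ suc (toℕ i)))
      ≈⟨ +-cong (trans (*-congʳ g0) (zeroˡ _)) (sum-cong-≋ {n} (λ i →
           trans (*-congˡ (^ₛ-vanishes g0 (≤-trans (n∸[1+i]<n i) n≤m))) (zeroʳ _))) ⟩
    0# + ∑[ i < n ] 0#
      ≈⟨ trans (+-identityˡ _) (sum-replicate-zero n) ⟩
    0# ∎
    where
    n∸[1+i]<n : ∀ {n} (i : Fin n) → n ∸ suc (toℕ i) <ⁿ n
    n∸[1+i]<n {suc n} i = s≤s (m∸n≤m n (toℕ i))

  -- The hypothesis says g(t) = a f(bt). In each product of coefficients the exponents i and n - i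
  -- of b add up to n, so b^n leaves the convolution.
  ^ₛ-rescale : ∀ a b {f g} → (∀ n → g n ≈ a * (b ^ n * f n)) →
    ∀ m n → (g ^ₛ m) n ≈ a ^ m * (b ^ n * (f ^ₛ m) n)
  ^ₛ-rescale a b g≈ zero zero    = sym (trans (*-identityˡ _) (*-identityˡ _))
  ^ₛ-rescale a b g≈ zero (suc n) = sym (trans (*-identityˡ _) (zeroʳ _))
  ^ₛ-rescale a b {f} {g} g≈ (suc m) n = begin
    ∑[ i < suc n ] (g (toℕ i) * (g ^ₛ m) (n ∸ toℕ i))
      ≈⟨ sum-cong-≋ {suc n} term ⟩
    ∑[ i < suc n ] (a ^ suc m * (b ^ n * terms i))
      ≈⟨ *-distribˡ-sum (a ^ suc m) (λ i → b ^ n * terms i) ⟨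
    a ^ suc m * ∑[ i < suc n ] (b ^ n * terms i)
      ≈⟨ *-congˡ (*-distribˡ-sum (b ^ n) terms) ⟨
    a ^ suc m * (b ^ n * (f ^ₛ suc m) n) ∎
    where
    terms : Fin (suc n) → Carrier
    terms i = f (toℕ i) * (f ^ₛ m) (n ∸ toℕ i)

    term : (i : Fin (suc n)) →
      g (toℕ i) * (g ^ₛ m) (n ∸ toℕ i) ≈ a ^ suc m * (b ^ n * terms i)
    term i = begin
      g j * (g ^ₛ m) (n ∸ j)
        ≈⟨ *-cong (g≈ j) (^ₛ-rescale a b g≈ m (n ∸ j)) ⟩
      (a * (b ^ j * f j)) * (a ^ m * (b ^ (n ∸ j) * (f ^ₛ m) (n ∸ j)))
        ≈⟨ solve 6 (λ a b x a' b' y → (a ⊕ (b ⊕ x)) ⊕ (a' ⊕ (b' ⊕ y))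
                                    ⊜ (a ⊕ a') ⊕ ((b ⊕ b') ⊕ (x ⊕ y)))
             refl a (b ^ j) (f j) (a ^ m) (b ^ (n ∸ j)) ((f ^ₛ m) (n ∸ j)) ⟩
      (a ^ suc m) * ((b ^ j * b ^ (n ∸ j)) * (f j * (f ^ₛ m) (n ∸ j)))
        ≈⟨ *-congˡ (*-congʳ (trans (sym (^-homo-* b j (n ∸ j)))
             (reflexive (cong (b ^_) (m+[n∸m]≡n (toℕ≤pred[n] i)))))) ⟩
      a ^ suc m * (b ^ n * (f j * (f ^ₛ m) (n ∸ j))) ∎
      where j = toℕ i

  -- For f = l(x)/x the right-hand side is the coefficient of l(g), so l(y) is recovered from l(y)/y
  -- without dividing by y.
  substitute-*ₛ : ∀ f g g0 n →
    (substitute f g g0 *ₛ g) n ≈ ∑[ m < n ] (f (toℕ m) * (g ^ₛ suc (toℕ m)) n)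
  substitute-*ₛ f g g0 n = begin
    ∑[ i < suc n ] (∑[ m < suc (toℕ i) ] terms (toℕ i) (toℕ m) * g (n ∸ toℕ i))
      -- The inner range depends on `i`. Padding it to `n` with vanishing powers makes the double
      -- sum rectangular, so its order can be exchanged.
      ≈⟨ sum-cong-≋ {suc n} (λ i → *-congʳ {g (n ∸ toℕ i)} (sum-extend (s≤s (toℕ≤pred[n] i))
           (terms (toℕ i)) (λ m i<m → vanish m (^ₛ-vanishes g0 i<m)))) ⟩
    ∑[ i < suc n ] (∑[ m < suc n ] terms (toℕ i) (toℕ m) * g (n ∸ toℕ i))
      ≈⟨ sum-cong-≋ {suc n} (λ i →
           *-distribʳ-sum {suc n} (g (n ∸ toℕ i)) (λ m → terms (toℕ i) (toℕ m))) ⟩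
    ∑[ i < suc n ] ∑[ m < suc n ] (terms (toℕ i) (toℕ m) * g (n ∸ toℕ i))
      ≈⟨ ∑-comm {suc n} {suc n} (λ i m → terms (toℕ i) (toℕ m) * g (n ∸ toℕ i)) ⟩
    ∑[ m < suc n ] ∑[ i < suc n ] (terms (toℕ i) (toℕ m) * g (n ∸ toℕ i))
      ≈⟨ sum-cong-≋ {suc n} (λ m → collect (toℕ m)) ⟩
    ∑[ m < suc n ] (f (toℕ m) * (g ^ₛ suc (toℕ m)) n)
      -- The term `m = n` drops out because `g ^ₛ suc n` starts in degree n + 1. What remains
      -- matches m = 1, ..., n in the theorem after a shift by one.
      ≈⟨ sum-extend (n≤1+n n) (λ m → f m * (g ^ₛ suc m) n)
           (λ m n≤m → vanish m (^ₛ-vanishes g0 (s≤s n≤m))) ⟨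
    ∑[ m < n ] (f (toℕ m) * (g ^ₛ suc (toℕ m)) n) ∎
    where
    terms : ℕ → ℕ → Carrier
    terms i m = f m * (g ^ₛ m) i

    vanish : ∀ m {x} → x ≈ 0# → f m * x ≈ 0#
    vanish m x≈0 = trans (*-congˡ x≈0) (zeroʳ _)

    collect : ∀ m → ∑[ i < suc n ] (terms (toℕ i) m * g (n ∸ toℕ i)) ≈ f m * (g ^ₛ suc m) n
    collect m = begin
      ∑[ i < suc n ] (terms (toℕ i) m * g (n ∸ toℕ i))
        ≈⟨ sum-cong-≋ {suc n} (λ i → *-assoc (f m) ((g ^ₛ m) (toℕ i)) (g (n ∸ toℕ i))) ⟩
      ∑[ i < suc n ] (f m * ((g ^ₛ m) (toℕ i) * g (n ∸ toℕ i)))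
        ≈⟨ *-distribˡ-sum {suc n} (f m) (λ i → (g ^ₛ m) (toℕ i) * g (n ∸ toℕ i)) ⟨
      f m * (g ^ₛ m *ₛ g) n
        ≈⟨ *-congˡ (*ₛ-comm (g ^ₛ m) g n) ⟩
      f m * (g ^ₛ suc m) n ∎

  -- Inverses and integer powers.

  *-inverseʳ : ∀ x → value x * value (x ⁻¹) ≈ 1#
  *-inverseʳ x = trans (*-congʳ (sym (x-0≈x (value x)))) (proj₂ (proj₂ (#⇒invertible (value#0 x))))

  ⁻¹-unique : ∀ x {y} → value x * y ≈ 1# → value (x ⁻¹) ≈ y
  ⁻¹-unique x {y} xy≈1 = begin
    value (x ⁻¹)                 ≈⟨ *-identityʳ _ ⟨
    value (x ⁻¹) * 1#            ≈⟨ *-congˡ xy≈1 ⟨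
    value (x ⁻¹) * (value x * y) ≈⟨ solve 3 (λ i x y → i ⊕ (x ⊕ y) ⊜ (x ⊕ i) ⊕ y) refl _ _ y ⟩
    value x * value (x ⁻¹) * y   ≈⟨ *-congʳ (*-inverseʳ x) ⟩
    1# * y                       ≈⟨ *-identityˡ y ⟩
    y                            ∎

  -- The cases follow the definition of `_^ᶻ_`. At exponent 0 the predecessor is already an inverse,
  -- that of `x ^ⁿ 1`.
  ^ᶻ-pred : ∀ x k → value (x ^ᶻ k) ≈ value x * value (x ^ᶻ (k -ᶻ 1ℤ))
  ^ᶻ-pred x (+ zero)  = sym (trans (*-congʳ (sym (*-identityʳ _))) (*-inverseʳ (x ^ⁿ 1)))
  ^ᶻ-pred x (+ suc n) = refl
  -- Here `k -ᶻ 1ℤ` computes to `-[1+ suc (n + 0) ]`, hence the rewrite. Then x times the inverse of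
  -- x^(n+2) is seen to invert x^(n+1).
  ^ᶻ-pred x -[1+ n ] rewrite +ⁿ-identityʳ n = ⁻¹-unique (x ^ⁿ suc n)
    (trans (solve 3 (λ x y i → y ⊕ (x ⊕ i) ⊜ (x ⊕ y) ⊕ i) refl
             (value x) (value (x ^ⁿ suc n)) (value ((x ^ⁿ suc (suc n)) ⁻¹)))
           (*-inverseʳ (x ^ⁿ suc (suc n))))

  -- With m = i + 1, one factor m moves from m^k to (m - 1)!. The resulting 1/m! is the one in the
  -- definition of `S₂`.
  polylog-denominator : ∀ k i →
    value ((ι! i *ⁿ ι⁺ (suc i) ^ᶻ k) ⁻¹)
      ≈ value ((ι⁺ (suc i) ^ᶻ (k -ᶻ 1ℤ)) ⁻¹) * value (ι! (suc i) ⁻¹)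
  polylog-denominator k i = ⁻¹-unique (ι! i *ⁿ M ^ᶻ k) (begin
    value (ι! i) * value (M ^ᶻ k) * (p⁻¹ * F⁻¹)
      ≈⟨ *-congʳ (*-congˡ (^ᶻ-pred M k)) ⟩
    value (ι! i) * (value M * p) * (p⁻¹ * F⁻¹)
      ≈⟨ solve 5 (λ a m p p' f → (a ⊕ (m ⊕ p)) ⊕ (p' ⊕ f) ⊜ (p ⊕ p') ⊕ ((m ⊕ a) ⊕ f))
           refl (value (ι! i)) (value M) p p⁻¹ F⁻¹ ⟩
    p * p⁻¹ * (value M * value (ι! i) * F⁻¹)
      ≈⟨ *-cong (*-inverseʳ (M ^ᶻ (k -ᶻ 1ℤ)))
           (trans (*-congʳ (sym (×1-homo-* (suc i) (i !)))) (*-inverseʳ (ι! (suc i)))) ⟩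
    1# * 1#
      ≈⟨ *-identityˡ 1# ⟩
    1# ∎)
    where
    M   = ι⁺ (suc i)
    p   = value (M ^ᶻ (k -ᶻ 1ℤ))
    p⁻¹ = value ((M ^ᶻ (k -ᶻ 1ℤ)) ⁻¹)
    F⁻¹ = value (ι! (suc i) ⁻¹)

  -- The degenerate exponential and the series y.

  -- The first factor `x - 0 × μ` is already zero.
  falling-0 : ∀ {x} → x ≈ 0# → ∀ n μ → falling x (suc n) μ ≈ 0#
  falling-0 x≈0 zero    μ = trans (*-identityˡ _) (trans (x-0≈x _) x≈0)
  falling-0 x≈0 (suc n) μ = trans (*-congʳ (falling-0 x≈0 n μ)) (zeroˡ _)

  degExp-0 : ∀ lam n → degExp lam 0# n ≈ 1ₛ n
  degExp-0 lam zero = trans (*-identityʳ _) (trans (*-identityˡ _)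
    (⁻¹-unique (ι! 0) (trans (*-identityʳ _) (+-identityʳ 1#))))
  degExp-0 lam (suc n) = trans (*-congʳ (trans (*-congʳ (falling-0 (zeroˡ _) n 1#)) (zeroˡ _))) (zeroˡ _)

  reflect-1ₛ : ∀ n → reflect 1ₛ n ≈ 1ₛ n
  reflect-1ₛ zero    = *-identityˡ 1#
  reflect-1ₛ (suc n) = zeroʳ _

  -1*[x-y]≈y-x : ∀ x y → - 1# * (x - y) ≈ y - x
  -1*[x-y]≈y-x x y = trans (-1*x≈-x _) (⁻¹-anti-homo‿- x y)

  -- Brings y into the form a f(bt) with a = b = -1 and f = e_λ - 1, as `^ₛ-rescale` requires.
  1-e[-t]-reflect : ∀ lam n →
    1-e[-t] lam n ≈ - 1# * reflect (degExp lam 1# -ₛ 1ₛ) n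
  1-e[-t]-reflect lam n = sym (begin
    - 1# * ((- 1#) ^ n * (degExp lam 1# n - 1ₛ n))
      ≈⟨ *-congˡ (x[y-z]≈xy-xz _ _ _) ⟩
    - 1# * (reflect (degExp lam 1#) n - reflect 1ₛ n)
      ≈⟨ -1*[x-y]≈y-x _ _ ⟩
    reflect 1ₛ n - reflect (degExp lam 1#) n
      ≈⟨ +-congʳ (reflect-1ₛ n) ⟩
    1ₛ n - reflect (degExp lam 1#) n ∎)

  reflect-degExp-difference : ∀ lam n →
    reflect (degExp lam 1#) n - reflect (degExp lam 0#) n ≈ - 1# * 1-e[-t] lam n
  reflect-degExp-difference lam n = trans
    (+-congˡ (-‿cong (trans (*-congˡ (degExp-0 lam n)) (reflect-1ₛ n))))
    (sym (-1*[x-y]≈y-x _ _))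

  -- Signs and the comparison of summands.

  -1^n*-1^n≈1 : ∀ n → (- 1#) ^ n * (- 1#) ^ n ≈ 1#
  -1^n*-1^n≈1 zero    = *-identityˡ 1#
  -1^n*-1^n≈1 (suc n) = begin
    (- 1# * s) * (- 1# * s)   ≈⟨ solve 2 (λ u s → (u ⊕ s) ⊕ (u ⊕ s) ⊜ (u ⊕ u) ⊕ (s ⊕ s)) refl (- 1#) s ⟩
    (- 1# * - 1#) * (s * s)   ≈⟨ *-cong (trans (-1*x≈-x (- 1#)) (-‿involutive 1#)) (-1^n*-1^n≈1 n) ⟩
    1# * 1#                   ≈⟨ *-identityˡ 1# ⟩
    1#                        ∎
    where s = (- 1#) ^ n

  -- The signs (-1)^i from (-λ)^i, (-1)^(i+1) from y^(i+1) and the outer -1 cancel.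
  polylog-term : ∀ lam k n i →
    value (ι! n) * (- 1# * (polylog lam k (suc i) * (1-e[-t] lam ^ₛ suc i) n))
      ≈ (- 1#) ^ n * (falling 1# (suc i) (1# / lam) / (ι⁺ (suc i) ^ᶻ (k -ᶻ 1ℤ))
                        * value lam ^ i * S₂ lam n (suc i))
  polylog-term lam k n i = begin
    N * (- 1# * ((- value lam) ^ i * ff * value ((ι! i *ⁿ ι⁺ (suc i) ^ᶻ k) ⁻¹)
                  * (1-e[-t] lam ^ₛ suc i) n))
      ≈⟨ *-congˡ (*-congˡ (*-cong
           (*-cong (*-congʳ (trans (^-congˡ i (sym (-1*x≈-x _))) (^-distrib-* (- 1#) (value lam) i)))
                   (polylog-denominator k i))
           (^ₛ-rescale (- 1#) (- 1#) (1-e[-t]-reflect lam) (suc i) n))) ⟩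
    N * (- 1# * ((s * L) * ff * (r * v) * (- 1# * s * (e * w))))
      -- The `id` on the right becomes the numerator of `1# / ι! (suc i)`, so that the innermost
      -- product is literally `S₂ lam n (suc i)`.
      ≈⟨ solve 9 (λ N u s L ff r v e w →
             N ⊕ (u ⊕ ((((s ⊕ L) ⊕ ff) ⊕ (r ⊕ v)) ⊕ ((u ⊕ s) ⊕ (e ⊕ w))))
           ⊜ ((u ⊕ s) ⊕ (u ⊕ s)) ⊕ (e ⊕ (((ff ⊕ r) ⊕ L) ⊕ (N ⊕ ((id ⊕ v) ⊕ w)))))
           refl N (- 1#) s L ff r v e w ⟩
    (- 1# * s) * (- 1# * s) * (e * (ff * r * L * (N * (1# * v * w))))
      ≈⟨ trans (*-congʳ (-1^n*-1^n≈1 (suc i))) (*-identityˡ _) ⟩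
    e * (ff * r * L * (N * (1# * v * w))) ∎
    where
    N  = value (ι! n)
    s  = (- 1#) ^ i
    e  = (- 1#) ^ n
    L  = value lam ^ i
    ff = falling 1# (suc i) (1# / lam)
    r  = value ((ι⁺ (suc i) ^ᶻ (k -ᶻ 1ℤ)) ⁻¹)
    v  = value (ι! (suc i) ⁻¹)
    w  = ((degExp lam 1# -ₛ 1ₛ) ^ₛ suc i) n

theorem7 : ∀ {c ℓ₁ ℓ₂} (K : HeytingField c ℓ₁ ℓ₂) (char0 : CharacteristicZero K) →
    let open HeytingField K
        open DegeneratePolyBernoulli K char0
    in (lam : Nonzero) (k : ℤ) (n : ℕ) → 1 ≤ n →
       β lam k n 1# - β lam k n 0# ≈
       (- 1#) ^ n * (∑[ i < n ] (let m = suc (toℕ i) in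
         falling 1# m (1# / lam) / (ι⁺ m ^ᶻ (k -ᶻ 1ℤ))
           * value lam ^ (m ∸ 1) * S₂ lam n m))
theorem7 K char0 lam k n _ = begin
    N * (F *ₛ reflect (degExp lam 1#)) n - N * (F *ₛ reflect (degExp lam 0#)) n
      ≈⟨ x[y-z]≈xy-xz N _ _ ⟨
    N * ((F *ₛ reflect (degExp lam 1#)) n - (F *ₛ reflect (degExp lam 0#)) n)
      ≈⟨ *-congˡ (*ₛ-distribˡ-difference K char0 F _ _ y (- 1#) (reflect-degExp-difference K char0 lam) n) ⟩
    N * (- 1# * (F *ₛ y) n)
      -- `F` is l(y)/y, so `F *ₛ y` is l(y); the shift in `divideByVariable` pairs coefficient i + 1
      -- of the polylogarithm with y^(i+1).
      ≈⟨ *-congˡ (*-congˡ (substitute-*ₛ K char0 (divideByVariable (polylog lam k)) y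
           (1-e[-t]-constant lam) n)) ⟩
    N * (- 1# * ∑[ i < n ] (polylog lam k (suc (toℕ i)) * (y ^ₛ suc (toℕ i)) n))
      ≈⟨ *-congˡ (*-distribˡ-sum {n} (- 1#) _) ⟩
    N * ∑[ i < n ] (- 1# * (polylog lam k (suc (toℕ i)) * (y ^ₛ suc (toℕ i)) n))
      ≈⟨ *-distribˡ-sum {n} N _ ⟩
    ∑[ i < n ] (N * (- 1# * (polylog lam k (suc (toℕ i)) * (y ^ₛ suc (toℕ i)) n)))
      ≈⟨ sum-cong-≋ {n} (λ i → polylog-term K char0 lam k n (toℕ i)) ⟩
    ∑[ i < n ] ((- 1#) ^ n * (falling 1# (suc (toℕ i)) (1# / lam) / (ι⁺ (suc (toℕ i)) ^ᶻ (k -ᶻ 1ℤ))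
                                * value lam ^ toℕ i * S₂ lam n (suc (toℕ i))))
      ≈⟨ *-distribˡ-sum {n} ((- 1#) ^ n) _ ⟨
    (- 1#) ^ n * ∑[ i < n ] (falling 1# (suc (toℕ i)) (1# / lam) / (ι⁺ (suc (toℕ i)) ^ᶻ (k -ᶻ 1ℤ))
                                * value lam ^ toℕ i * S₂ lam n (suc (toℕ i))) ∎
  where
  open HeytingField K
  open DegeneratePolyBernoulli K char0
  open HeytingCommutativeRing heytingCommutativeRing using (commutativeRing)
  open CommutativeRing commutativeRing using (ring; semiring; +-commutativeMonoid)
  open RingProperties ring using (x[y-z]≈xy-xz)
  open SumProperties +-commutativeMonoid using (sum-cong-≋)
  open SemiringSumProperties semiring using (*-distribˡ-sum)
  open SetoidReasoning setoid

  N = value (ι! n)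
  y = 1-e[-t] lam
  F = substitute (divideByVariable (polylog lam k)) y (1-e[-t]-constant lam)
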